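{- Let $G$ be a finite simple undirected graph, let $\tau$ be the visiting ordering of a maxBFS on $G$, and let $\tau^d$ be the reverse ordering of $\tau$. Then: (1) $\tau^d$ has no three vertices $a<_{\tau^d} b<_{\tau^d} c$ with $ab\in E(G)$ if and only if $G$ is a star; (2) $\tau^d$ has no three vertices $a<_{\tau^d} b<_{\tau^d} c$ with $ab\in E(G)$ and $bc\notin E(G)$ if and only if $G$ is a split graph.
   Context: A graph is a split graph if its vertex set can be partitioned into two (possibly empty) parts, the first inducing a clique and the second inducing an independent set. A star is a split graph in which at most one vertex has more than one neighbour (isolated vertices are allowed). BFS is the standard Breadth First Search implemented with a queue. A maxBFS is a BFS in which ties between eligible vertices are broken by largest degree (degrees in the searched graph, a fixed priority during the whole search): the search starts at a vertex of maximum degree; when a vertex is processed, its not yet discovered neighbours are put in the queue in decreasing order of degree (remaining ties broken arbitrarily); if the graph is disconnected, when the queue is empty the search restarts at an unvisited vertex of largest degree. -}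

module Defs where

open import Data.Fin using (Fin)
open import Data.Fin.Subset using (Subset) renaming (_∈_ to _∈ˢ_; _∉_ to _∉ˢ_)
open import Data.List using (List; []; _∷_; _++_; [_]; allFin; filter; length)
open import Data.List.Membership.Propositional using (_∈_; _∉_)
open import Data.List.Relation.Binary.Sublist.Propositional using (_⊆_)
open import Data.List.Relation.Unary.AllPairs using (AllPairs)
open import Data.List.Relation.Unary.Unique.Propositional using (Unique)
open import Data.Nat using (ℕ; _≤_; _≥_; _>_)
open import Data.Product using (_×_; Σ-syntax)
open import Function using (_⇔_)
open import Level using (0ℓ)
open import Relation.Binary using (Rel; Decidable; Symmetric; Irreflexive)
open import Relation.Binary.PropositionalEquality using (_≡_; _≢_)
open import Relation.Nullary using (¬_)

record Graph (n : ℕ) : Set₁ where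
  infix 4 _~_ _~?_
  field
    _~_      : Rel (Fin n) 0ℓ
    _~?_     : Decidable _~_
    ~-sym    : Symmetric _~_
    ~-irrefl : Irreflexive _≡_ _~_

  neighbours : Fin n → List (Fin n)
  neighbours v = filter (v ~?_) (allFin n)

  degree : Fin n → ℕ
  degree v = length (neighbours v)

module _ {n : ℕ} (G : Graph n) where
  open Graph G

  IsClique : (Fin n → Set) → Set
  IsClique P = ∀ {u v} → P u → P v → u ≢ v → u ~ v

  IsIndependent : (Fin n → Set) → Set
  IsIndependent P = ∀ {u v} → P u → P v → ¬ u ~ v

  IsSplit : Set
  IsSplit = Σ[ K ∈ Subset n ] (IsClique (_∈ˢ K) × IsIndependent (_∉ˢ K))

  IsStar : Set
  IsStar = IsSplit × (∀ {u v} → degree u > 1 → degree v > 1 → u ≡ v)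

  -- MaxBFS queue visited τ: from the state with the given queue and list of
  -- already visited vertices, the search can be completed by visiting the
  -- vertices of τ in order. The discovered vertices of a state are those that
  -- are visited or queued. The rule `restart` also makes the first choice of
  -- vertex.
  data MaxBFS : (queue visited : List (Fin n)) → List (Fin n) → Set where
    done : ∀ {visited} →
      (∀ v → v ∈ visited) →
      MaxBFS [] visited []

    restart : ∀ {visited τ} v →
      v ∉ visited →
      (∀ w → w ∉ visited → degree w ≤ degree v) →
      MaxBFS [ v ] visited τ →
      MaxBFS [] visited τ

    visit : ∀ {v queue visited τ} new →
      Unique new →
      (∀ w → w ∈ new ⇔ (v ~ w × w ∉ visited × w ∉ v ∷ queue)) →
      AllPairs (λ u w → degree u ≥ degree w) new →
      MaxBFS (queue ++ new) (v ∷ visited) τ →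
      MaxBFS (v ∷ queue) visited (v ∷ τ)

  IsMaxBFSOrdering : List (Fin n) → Set
  IsMaxBFSOrdering τ = MaxBFS [] [] τ

-- a precedes b in σ: the two occur in σ, in this order, possibly with other
-- entries in between.
infix 4 _<[_]_
_<[_]_ : ∀ {A : Set} → A → List A → A → Set
a <[ σ ] b = (a ∷ b ∷ []) ⊆ σ

{-# OPTIONS --safe #-}
-- In terms of τ, the patterns read c, b, a from left to right. Let s be the
-- first vertex of τ. It has maximum degree, its neighbours directly follow it
-- in τ, and they are sorted by decreasing degree; nothing else about the search
-- is needed.
--
-- (1) τ avoids the pattern iff every edge contains s. If G is a star with an edge
-- avoiding s, the clique part joins this edge to an edge at s, so an endpoint of
-- the former has degree at least 2 and must be s, by maximality of the degree of s.
--
-- (2) τ avoids the pattern iff every vertex with a later neighbour is adjacent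
-- to all earlier vertices; then these vertices form the clique of a split
-- partition. Conversely, let (K , I) be a split partition with s in K (if s is in I
-- and has a neighbour, it is adjacent to all of K and can be moved there). If
-- c, b, a is a pattern, then b and c are neighbours of s, and comparing
-- deg c ≥ deg b, as well as deg b ≥ deg a for a in K, with |K| gives a
-- contradiction in each case.
module Submission where

open import Defs
open import Data.Empty using (⊥)
open import Data.Fin using (Fin; _≟_)
open import Data.Fin.Properties using (any?)
open import Data.Fin.Subset using (Subset) renaming (_∈_ to _∈ˢ_)
open import Data.Fin.Subset.Properties using () renaming (_∈?_ to _∈ˢ?_)
open import Data.List using (List; []; _∷_; _++_; [_]; length; filter; allFin; reverse)
open import Data.List.Membership.Propositional using (_∈_; _∉_)
open import Data.List.Membership.Propositional.Properties
  using (∈-∃++; ∈-++⁺ˡ; ∈-++⁺ʳ; ∈-++⁻; ∈-filter⁺; ∈-filter⁻; ∈-allFin)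
open import Data.List.Properties using (length-++; length-++-sucʳ; ++-assoc; reverse-involutive)
open import Data.List.Relation.Binary.Disjoint.Propositional using (Disjoint)
import Data.List.Relation.Binary.Sublist.DecPropositional as DecSublist
open import Data.List.Relation.Binary.Sublist.Propositional
  using (_∷_; _∷ʳ_; from∈; to∈; lookup)
open import Data.List.Relation.Binary.Sublist.Propositional.Properties using (reverse⁺)
open import Data.List.Relation.Unary.All as All using (All; []; _∷_)
open import Data.List.Relation.Unary.AllPairs as AllPairs using (AllPairs; []; _∷_)
open import Data.List.Relation.Unary.Any using (here; there)
open import Data.List.Relation.Unary.Unique.Propositional using (Unique)
open import Data.List.Relation.Unary.Unique.Propositional.Properties as Unique
  using (Unique[x∷xs]⇒x∉xs)
open import Data.Nat using (ℕ; suc; _≤_; _<_; _>_; _+_; z≤n; s≤s; s≤s⁻¹; _≤?_)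
open import Data.Nat.Properties
  using (≤-trans; <⇒≱; <-≤-trans; ≰⇒>; module ≤-Reasoning)
open import Data.Product using (_×_; _,_; proj₁; proj₂; ∃; ∃-syntax)
open import Data.Sum using (_⊎_; inj₁; inj₂)
open import Data.Vec using (tabulate)
open import Data.Vec.Properties using ([]=⇒lookup; lookup⇒[]=; lookup∘tabulate)
open import Function using (_⇔_; mk⇔; _∘_; Equivalence)
open import Relation.Binary.PropositionalEquality
  using (_≡_; _≢_; refl; sym; trans; cong; subst; ≢-sym)
open import Relation.Nullary using (¬_; yes; no; does; contradiction)
open import Relation.Nullary.Decidable using (_⊎-dec_; _×-dec_; dec-true; decidable-stable)
open import Relation.Unary using (Decidable)

-- Duplicate-free lists and the order of entries in a list.

module _ {A : Set} where

  -- Pigeonhole, the source of all degree bounds below. By induction: after one occurrence of the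
  -- head of `xs` is cut out of `ys`, the rest of `xs` is still contained in what remains, as it
  -- does not contain that head.
  unique-length-≤ : {xs ys : List A} → Unique xs → (∀ {x} → x ∈ xs → x ∈ ys) →
    length xs ≤ length ys
  unique-length-≤ [] _ = z≤n
  unique-length-≤ {x ∷ xs} u@(_ ∷ u′) sub with ∈-∃++ (sub (here refl))
  ... | as , bs , refl = begin
    suc (length xs)         ≤⟨ s≤s (unique-length-≤ u′ skip) ⟩
    suc (length (as ++ bs)) ≡⟨ length-++-sucʳ as x bs ⟨
    length (as ++ x ∷ bs)   ∎
    where
    open ≤-Reasoning
    skip : ∀ {y} → y ∈ xs → y ∈ as ++ bs
    skip y∈xs with ∈-++⁻ as (sub (there y∈xs))
    ... | inj₁ y∈as         = ∈-++⁺ˡ y∈as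
    ... | inj₂ (here refl)  = contradiction y∈xs (Unique[x∷xs]⇒x∉xs u)
    ... | inj₂ (there y∈bs) = ∈-++⁺ʳ as y∈bs

  Unique-++⁻-disjoint : ∀ xs {ys : List A} → Unique (xs ++ ys) → Disjoint xs ys
  Unique-++⁻-disjoint (x ∷ xs) u (here refl , x∈ys) =
    Unique[x∷xs]⇒x∉xs u (∈-++⁺ʳ xs x∈ys)
  Unique-++⁻-disjoint (x ∷ xs) (_ ∷ u) (there v∈xs , v∈ys) =
    Unique-++⁻-disjoint xs u (v∈xs , v∈ys)

  module _ {x y : A} where

    <⇒∈ˡ : ∀ {σ} → x <[ σ ] y → x ∈ σ
    <⇒∈ˡ = to∈

    <⇒∈ʳ : ∀ {σ} → x <[ σ ] y → y ∈ σ
    <⇒∈ʳ x<y = lookup x<y (there (here refl))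

    <-reverse⁺ : ∀ {σ} → x <[ σ ] y → y <[ reverse σ ] x
    <-reverse⁺ = reverse⁺

    <-reverse⁻ : ∀ {σ} → x <[ reverse σ ] y → y <[ σ ] x
    <-reverse⁻ {σ} x<y = subst (y <[_] x) (reverse-involutive σ) (<-reverse⁺ x<y)

    <-++⁻ˡ : ∀ xs {ys} → y ∉ ys → x <[ xs ++ ys ] y → x <[ xs ] y
    <-++⁻ˡ []       y∉ys x<y           = contradiction (<⇒∈ʳ x<y) y∉ys
    <-++⁻ˡ (z ∷ xs) y∉ys (.z ∷ʳ x<y)   = z ∷ʳ <-++⁻ˡ xs y∉ys x<y
    <-++⁻ˡ (z ∷ xs) y∉ys (refl ∷ y∈) with ∈-++⁻ xs (to∈ y∈)
    ... | inj₁ y∈xs = refl ∷ from∈ y∈xs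
    ... | inj₂ y∈ys = contradiction y∈ys y∉ys

    <-total : ∀ {σ} → x ≢ y → x ∈ σ → y ∈ σ → x <[ σ ] y ⊎ y <[ σ ] x
    <-total x≢y (here refl) (here refl) = contradiction refl x≢y
    <-total x≢y (here refl) (there y∈)  = inj₁ (refl ∷ from∈ y∈)
    <-total x≢y (there x∈)  (here refl) = inj₂ (refl ∷ from∈ x∈)
    <-total x≢y (there x∈)  (there y∈) with <-total x≢y x∈ y∈
    ... | inj₁ x<y = inj₁ (_ ∷ʳ x<y)
    ... | inj₂ y<x = inj₂ (_ ∷ʳ y<x)

    AllPairs-< : ∀ {R : A → A → Set} {σ} → AllPairs R σ → x <[ σ ] y → R x y
    AllPairs-< (_ ∷ Rσ)  (_ ∷ʳ x<y)  = AllPairs-< Rσ x<y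
    AllPairs-< (Rx ∷ _) (refl ∷ y∈) = All.lookup Rx (to∈ y∈)

-- Subsets from decidable predicates.

module _ {n : ℕ} {P : Fin n → Set} (P? : Decidable P) where

  subset : Subset n
  subset = tabulate (λ v → does (P? v))

  ∈-subset⁺ : ∀ {v} → P v → v ∈ˢ subset
  ∈-subset⁺ {v} p =
    lookup⇒[]= v subset (trans (lookup∘tabulate _ v) (dec-true (P? v) p))

  ∈-subset⁻ : ∀ {v} → v ∈ˢ subset → P v
  ∈-subset⁻ {v} v∈ with P? v | trans (sym (lookup∘tabulate (λ v → does (P? v)) v)) ([]=⇒lookup v∈)
  ... | yes p | _  = p
  ... | no _  | ()

-- Neighbourhoods and degrees.

module _ {n : ℕ} (G : Graph n) where
  open Graph G

  ~-distinct : ∀ {u v} → u ~ v → u ≢ v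
  ~-distinct u~v u≡v = ~-irrefl u≡v u~v

  ∈-neighbours⁺ : ∀ {v w} → v ~ w → w ∈ neighbours v
  ∈-neighbours⁺ {v} {w} = ∈-filter⁺ (v ~?_) (∈-allFin w)

  ∈-neighbours⁻ : ∀ {v w} → w ∈ neighbours v → v ~ w
  ∈-neighbours⁻ {v} = proj₂ ∘ ∈-filter⁻ (v ~?_) {xs = allFin n}

  neighbours-unique : ∀ v → Unique (neighbours v)
  neighbours-unique v = Unique.filter⁺ (v ~?_) (Unique.allFin⁺ n)

  length≤degree : ∀ {v ws} → Unique ws → All (v ~_) ws → length ws ≤ degree v
  length≤degree u v~ws = unique-length-≤ u (∈-neighbours⁺ ∘ All.lookup v~ws)

  neighbour : ∀ v → 1 ≤ degree v → ∃ (v ~_)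
  neighbour v 1≤deg with neighbours v | ∈-neighbours⁻ {v}
  ... | w ∷ _ | v~ = w , v~ (here refl)

  -- Properties of maxBFS orderings.

  MaxBFS-prefix : ∀ {queue visited τ} → MaxBFS G queue visited τ → ∃[ ρ ] τ ≡ queue ++ ρ
  MaxBFS-prefix (done _)          = [] , refl
  MaxBFS-prefix (restart _ _ _ _) = _ , refl
  -- New vertices join the back of the queue, so the vertices queued now come first, in queue order.
  MaxBFS-prefix (visit {v} {queue} new _ _ _ m) with MaxBFS-prefix m
  ... | ρ , refl = new ++ ρ , cong (v ∷_) (++-assoc queue new ρ)

  MaxBFS-complete : ∀ {queue visited τ} → MaxBFS G queue visited τ →
    ∀ v → v ∈ visited ⊎ v ∈ τ
  MaxBFS-complete (done all)        v = inj₁ (all v)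
  MaxBFS-complete (restart _ _ _ m) v = MaxBFS-complete m v
  MaxBFS-complete (visit _ _ _ _ m) v with MaxBFS-complete m v
  ... | inj₁ (here refl) = inj₂ (here refl)
  ... | inj₁ (there v∈)  = inj₁ v∈
  ... | inj₂ v∈          = inj₂ (there v∈)

  -- The two hypotheses are the search invariant. A visit preserves it because `new` contains no
  -- discovered vertex, and a restart because it picks an unvisited one.
  MaxBFS-unique : ∀ {queue visited τ} → MaxBFS G queue visited τ →
    Unique queue → Disjoint queue visited → Unique τ × Disjoint τ visited
  MaxBFS-unique (done _) _ _ = [] , λ ()
  MaxBFS-unique (restart v v∉ _ m) _ _ =
    MaxBFS-unique m ([] ∷ []) λ { (here refl , v∈) → v∉ v∈ }
  MaxBFS-unique (visit {v} {queue} {visited} {τ} new new-unique new⇔ _ m) u@(_ ∷ u′) d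
    with MaxBFS-unique m (Unique.++⁺ u′ new-unique queue-new) queue-visited
    where
    queue-new : Disjoint queue new
    queue-new (w∈queue , w∈new) =
      proj₂ (proj₂ (Equivalence.to (new⇔ _) w∈new)) (there w∈queue)
    queue-visited : Disjoint (queue ++ new) (v ∷ visited)
    queue-visited (w∈ , w∈vis) with ∈-++⁻ queue w∈ | w∈vis
    ... | inj₁ w∈queue | here refl   = Unique[x∷xs]⇒x∉xs u w∈queue
    ... | inj₁ w∈queue | there w∈vis = d (there w∈queue , w∈vis)
    ... | inj₂ w∈new   | here refl   =
      proj₂ (proj₂ (Equivalence.to (new⇔ _) w∈new)) (here refl)
    ... | inj₂ w∈new   | there w∈vis =
      proj₁ (proj₂ (Equivalence.to (new⇔ _) w∈new)) w∈vis
  ... | τ-unique , τ-visited =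
    All.tabulate (λ w∈τ v≡w → τ-visited (w∈τ , here (sym v≡w))) ∷ τ-unique ,
    λ { (here refl , v∈) → d (here refl , v∈)
      ; (there w∈τ , w∈) → τ-visited (w∈τ , there w∈) }

  ordering-complete : ∀ {τ} → IsMaxBFSOrdering G τ → ∀ v → v ∈ τ
  ordering-complete bfs v with MaxBFS-complete bfs v
  ... | inj₂ v∈τ = v∈τ

  ordering-unique : ∀ {τ} → IsMaxBFSOrdering G τ → Unique τ
  ordering-unique bfs = proj₁ (MaxBFS-unique bfs [] λ ())

  head-maximum : ∀ {s σ} → IsMaxBFSOrdering G (s ∷ σ) → ∀ v → degree v ≤ degree s
  head-maximum (restart _ _ max (visit _ _ _ _ _)) v = max v λ ()

  -- One condition on pairs encodes both that the neighbours of `s` form an initial segment of `σ`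
  -- and that this segment is sorted by decreasing degree.
  NeighboursFirst : Fin n → List (Fin n) → Set
  NeighboursFirst s σ = ∀ {x y} → x <[ σ ] y → s ~ y → s ~ x × degree y ≤ degree x

  -- Right after the first visit the queue is exactly `new`, which then holds all neighbours of `s`,
  -- so `σ` is `new ++ ρ`. Since `σ` has no repetition, a neighbour `y` does not recur in `ρ`, and
  -- whatever precedes `y` is in `new` too.
  head-neighboursFirst : ∀ {s σ} → IsMaxBFSOrdering G (s ∷ σ) → NeighboursFirst s σ
  head-neighboursFirst bfs@(restart s _ _ (visit new _ new⇔ sorted m)) {y = y} x<y s~y
    with MaxBFS-prefix m | ordering-unique bfs
  ... | ρ , refl | _ ∷ u = proj₁ (Equivalence.to (new⇔ _) (<⇒∈ˡ x<y′)) , AllPairs-< sorted x<y′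
    where
    y∈new : y ∈ new
    y∈new = Equivalence.from (new⇔ y)
      (s~y , (λ ()) , λ { (here y≡s) → ~-irrefl (sym y≡s) s~y })
    x<y′ = <-++⁻ˡ new (λ y∈ρ → Unique-++⁻-disjoint new u (y∈new , y∈ρ)) x<y

  -- Degree counts in a split partition.

  module SplitPartition {K : Fin n → Set} (K? : Decidable K)
    (clique : IsClique G K) (independent : IsIndependent G (λ v → ¬ K v)) where

    members : List (Fin n)
    members = filter K? (allFin n)

    ∈-members⁺ : ∀ {v} → K v → v ∈ members
    ∈-members⁺ {v} = ∈-filter⁺ K? (∈-allFin v)

    ∈-members⁻ : ∀ {v} → v ∈ members → K v
    ∈-members⁻ = proj₂ ∘ ∈-filter⁻ K? {xs = allFin n}

    members-unique : Unique members
    members-unique = Unique.filter⁺ K? (Unique.allFin⁺ n)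

    κ : ℕ
    κ = length members

    outside-neighbour : ∀ {u v} → ¬ K u → u ~ v → K v
    outside-neighbour {v = v} u∉K u~v with K? v
    ... | yes v∈K = v∈K
    ... | no  v∉K = contradiction u~v (independent u∉K v∉K)

    -- The closed neighbourhood of `v` contains `es` and all of `K`; the `suc` counts `v` itself,
    -- which is among the `members`.
    clique-degree : ∀ {v} → K v → ∀ es → Unique es → All (λ e → ¬ K e × v ~ e) es →
      length es + κ ≤ suc (degree v)
    clique-degree {v} v∈K es u all = begin
      length es + κ          ≡⟨ length-++ es ⟨
      length (es ++ members) ≤⟨ unique-length-≤ (Unique.++⁺ u members-unique disjoint) sub ⟩
      suc (degree v)         ∎
      where
      open ≤-Reasoning
      disjoint : Disjoint es members
      disjoint (e∈es , e∈K) = proj₁ (All.lookup all e∈es) (∈-members⁻ e∈K)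
      sub : ∀ {w} → w ∈ es ++ members → w ∈ v ∷ neighbours v
      sub {w} w∈ with ∈-++⁻ es w∈ | w ≟ v
      ... | _         | yes w≡v = here w≡v
      ... | inj₁ w∈es | no _    = there (∈-neighbours⁺ (proj₂ (All.lookup all w∈es)))
      ... | inj₂ w∈K  | no w≢v  = there (∈-neighbours⁺ (clique v∈K (∈-members⁻ w∈K) (≢-sym w≢v)))

    -- By independence all neighbours of `v` lie in `K`, where they leave room for the
    -- non-neighbours `ds`.
    outside-degree : ∀ {v} → ¬ K v → ∀ ds → Unique ds → All (λ d → K d × ¬ v ~ d) ds →
      length ds + degree v ≤ κ
    outside-degree {v} v∉K ds u all = begin
      length ds + degree v         ≡⟨ length-++ ds ⟨
      length (ds ++ neighbours v) ≤⟨ unique-length-≤ (Unique.++⁺ u (neighbours-unique v) disjoint) sub ⟩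
      κ                            ∎
      where
      open ≤-Reasoning
      disjoint : Disjoint ds (neighbours v)
      disjoint (d∈ds , d∈N) = proj₂ (All.lookup all d∈ds) (∈-neighbours⁻ d∈N)
      sub : ∀ {w} → w ∈ ds ++ neighbours v → w ∈ members
      sub w∈ with ∈-++⁻ ds w∈
      ... | inj₁ w∈ds = ∈-members⁺ (proj₁ (All.lookup all w∈ds))
      ... | inj₂ w∈N  = ∈-members⁺ (outside-neighbour v∉K (∈-neighbours⁻ w∈N))

    clique-degree₁ : ∀ {v e} → K v → ¬ K e → v ~ e → κ ≤ degree v
    clique-degree₁ v∈K e∉K v~e =
      s≤s⁻¹ (clique-degree v∈K [ _ ] ([] ∷ []) ((e∉K , v~e) ∷ []))

    outside-degree₁ : ∀ {v d} → ¬ K v → K d → ¬ v ~ d → degree v < κ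
    outside-degree₁ v∉K d∈K v≁d =
      outside-degree v∉K [ _ ] ([] ∷ []) ((d∈K , v≁d) ∷ [])

    -- Here `a` lies in `K`. Suppose `b` and `c` are not adjacent. If `c` is in `K`, then deg b < κ
    -- ≤ deg a. If `c` is outside `K` and not adjacent to `a`, then deg c < κ ≤ deg a. If `c` is
    -- outside and adjacent to `a`, the outside neighbours `b` and `c` force deg a > κ ≥ deg b. Each
    -- case contradicts the order of the degrees.
    ~-earlier-outside : ∀ {a b c} → ¬ K b → b ≢ c → a ~ b →
      degree a ≤ degree b → degree b ≤ degree c → b ~ c
    ~-earlier-outside {a} {b} {c} b∉K b≢c a~b a≤b b≤c
      with outside-neighbour b∉K (~-sym a~b) | K? c | b ~? c
    ... | _   | _       | yes b~c = b~c
    ... | a∈K | yes c∈K | no b≁c  = contradiction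
      (≤-trans (clique-degree₁ a∈K b∉K a~b) a≤b) (<⇒≱ (outside-degree₁ b∉K c∈K b≁c))
    ... | a∈K | no c∉K  | no _ with c ~? a
    ...   | no c≁a  = contradiction
      (≤-trans (≤-trans (clique-degree₁ a∈K b∉K a~b) a≤b) b≤c) (<⇒≱ (outside-degree₁ c∉K a∈K c≁a))
    ...   | yes c~a = contradiction
      (≤-trans a≤b (outside-degree b∉K [] [] []))
      (<⇒≱ (s≤s⁻¹ (clique-degree a∈K (b ∷ c ∷ []) ((b≢c ∷ []) ∷ [] ∷ [])
        ((b∉K , a~b) ∷ (c∉K , ~-sym c~a) ∷ []))))

    -- Only `c` outside `K` is at issue; if it misses `b`, then deg c < κ. An outside `a` gives κ ≤
    -- deg b, and an `a` in `K` adjacent to `c` gives κ ≤ deg a. If `c` misses both `a` and `b`,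
    -- then deg c + 2 ≤ κ ≤ deg b + 1. The bound on deg a is conditional because it comes from `a`
    -- being a neighbour of `s`, which is known for `a` in `K`.
    ~-earlier-clique : ∀ {a b c} → K b → b ≢ c → a ~ b →
      (K a → degree a ≤ degree b) → degree b ≤ degree c → b ~ c
    ~-earlier-clique {a} {b} {c} b∈K b≢c a~b a≤b b≤c with K? c | b ~? c
    ... | _       | yes b~c = b~c
    ... | yes c∈K | no b≁c  = clique b∈K c∈K b≢c
    ... | no c∉K  | no b≁c with K? a | c ~? a
    ...   | no a∉K  | _       = contradiction
      (≤-trans (clique-degree₁ b∈K a∉K (~-sym a~b)) b≤c)
      (<⇒≱ (outside-degree₁ c∉K b∈K (b≁c ∘ ~-sym)))
    ...   | yes a∈K | yes c~a = contradiction
      (≤-trans (≤-trans (clique-degree₁ a∈K c∉K (~-sym c~a)) (a≤b a∈K)) b≤c)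
      (<⇒≱ (outside-degree₁ c∉K b∈K (b≁c ∘ ~-sym)))
    ...   | yes a∈K | no c≁a  = contradiction b≤c (<⇒≱ (s≤s⁻¹ (≤-trans
      (outside-degree c∉K (a ∷ b ∷ []) ((~-distinct a~b ∷ []) ∷ [] ∷ [])
        ((a∈K , c≁a) ∷ (b∈K , b≁c ∘ ~-sym) ∷ []))
      (clique-degree b∈K [] [] []))))

    module _ {s σ} (s∈K : K s) (first : NeighboursFirst s σ) (s∷σ-unique : Unique (s ∷ σ)) where

      private
        s≢ : ∀ {v} → v ∈ σ → s ≢ v
        s≢ v∈σ refl = Unique[x∷xs]⇒x∉xs s∷σ-unique v∈σ

        σ-unique : Unique σ
        σ-unique = AllPairs.tail s∷σ-unique

      head-~ : ∀ {a b} → b <[ σ ] a → a ~ b → s ~ b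
      head-~ {b = b} b<a a~b with K? b
      ... | yes b∈K = clique s∈K b∈K (s≢ (<⇒∈ˡ b<a))
      -- Now `a` is in `K`, hence a neighbour of `s`, and so is everything before it in `σ`.
      ... | no  b∉K = proj₁ (first b<a
        (clique s∈K (outside-neighbour b∉K (~-sym a~b)) (s≢ (<⇒∈ʳ b<a))))

      later-degree : ∀ {a b} → b <[ σ ] a → K a → degree a ≤ degree b
      later-degree b<a a∈K = proj₂ (first b<a (clique s∈K a∈K (s≢ (<⇒∈ʳ b<a))))

      ~-earlier : ∀ {a b c} → c <[ s ∷ σ ] b → b <[ s ∷ σ ] a → a ~ b → b ~ c
      ~-earlier (refl ∷ b∈) (refl ∷ _) _ = contradiction refl (s≢ (to∈ b∈))
      ~-earlier (_ ∷ʳ c<b) (refl ∷ _) _ = contradiction refl (s≢ (<⇒∈ʳ c<b))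
      -- Here `c` is `s` itself.
      ~-earlier (refl ∷ _) (_ ∷ʳ b<a) a~b = ~-sym (head-~ b<a a~b)
      ~-earlier {b = b} (_ ∷ʳ c<b) (_ ∷ʳ b<a) a~b
        with K? b | ≢-sym (AllPairs-< σ-unique c<b) | proj₂ (first c<b (head-~ b<a a~b))
      ... | yes b∈K | b≢c | b≤c = ~-earlier-clique b∈K b≢c a~b (later-degree b<a) b≤c
      ... | no b∉K  | b≢c | b≤c = ~-earlier-outside b∉K b≢c a~b
        (later-degree b<a (outside-neighbour b∉K (~-sym a~b))) b≤c

    module Extend {s} (s∉K : ¬ K s) (complete : ∀ {v} → K v → s ~ v) where

      K⁺ : Fin n → Set
      K⁺ v = K v ⊎ v ≡ s

      K⁺? : Decidable K⁺
      K⁺? v = K? v ⊎-dec v ≟ s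

      clique⁺ : IsClique G K⁺
      clique⁺ (inj₁ u∈K)  (inj₁ v∈K)  u≢v = clique u∈K v∈K u≢v
      clique⁺ (inj₁ u∈K)  (inj₂ refl) _   = ~-sym (complete u∈K)
      clique⁺ (inj₂ refl) (inj₁ v∈K)  _   = complete v∈K
      clique⁺ (inj₂ refl) (inj₂ refl) u≢v = contradiction refl u≢v

      independent⁺ : IsIndependent G (λ v → ¬ K⁺ v)
      independent⁺ u∉ v∉ = independent (u∉ ∘ inj₁) (v∉ ∘ inj₁)

    -- The neighbour `v` is in `K` and has the outside neighbour `s`, so κ ≤ deg v ≤ deg s; a member
    -- of `K` missed by `s` would give deg s < κ.
    maximum-complete : ∀ {s v} → (∀ w → degree w ≤ degree s) → ¬ K s → s ~ v →
      ∀ {w} → K w → s ~ w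
    maximum-complete {s} {v} max s∉K s~v {w} w∈K = decidable-stable (s ~? w) λ s≁w →
      <⇒≱ (outside-degree₁ s∉K w∈K s≁w)
        (≤-trans (clique-degree₁ (outside-neighbour s∉K s~v) s∉K (~-sym s~v)) (max v))

  -- Forbidden patterns and split graphs.

  HasLaterEdge : List (Fin n) → Set
  HasLaterEdge τ = ∃[ a ] ∃[ b ] ∃[ c ] (c <[ τ ] b × b <[ τ ] a × a ~ b)

  HasLaterEdgeNonEdge : List (Fin n) → Set
  HasLaterEdgeNonEdge τ =
    ∃[ a ] ∃[ b ] ∃[ c ] (c <[ τ ] b × b <[ τ ] a × a ~ b × ¬ b ~ c)

  split⇒avoids : ∀ {τ} → IsMaxBFSOrdering G τ → IsSplit G → ¬ HasLaterEdgeNonEdge τ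
  split⇒avoids {[]} _ _ (_ , _ , _ , () , _)
  split⇒avoids {s ∷ σ} bfs (S , clique , independent) (a , b , c , c<b , b<a , a~b , b≁c)
    with s ∈ˢ? S
  ... | yes s∈S = b≁c (~-earlier s∈S (head-neighboursFirst bfs) (ordering-unique bfs) c<b b<a a~b)
    where open SplitPartition (_∈ˢ? S) clique independent
  ... | no s∉S = b≁c (SplitPartition.~-earlier K⁺? clique⁺ independent⁺ (inj₂ refl)
      (head-neighboursFirst bfs) (ordering-unique bfs) c<b b<a a~b)
    where
    open SplitPartition (_∈ˢ? S) clique independent
    max = head-maximum bfs
    -- The edge from `a` to `b` makes the maximum degree positive.
    s-neighbour : ∃ (s ~_)
    s-neighbour = neighbour s (≤-trans (length≤degree ([] ∷ []) (a~b ∷ [])) (max a))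
    open Extend s∉S (maximum-complete max s∉S (proj₂ s-neighbour))

  avoids⇒split : ∀ {τ} → IsMaxBFSOrdering G τ → ¬ HasLaterEdgeNonEdge τ → IsSplit G
  avoids⇒split {τ} bfs avoids =
    subset P? , clique , λ u∉ v∉ → independent (u∉ ∘ ∈-subset⁺ P?) (v∉ ∘ ∈-subset⁺ P?)
    where
    P : Fin n → Set
    P v = ∃[ w ] (v <[ τ ] w × w ~ v)

    P? : Decidable P
    P? v = any? λ w → (DecSublist._⊆?_ _≟_ (v ∷ w ∷ []) τ) ×-dec (w ~? v)

    ordered : ∀ {u v} → u ≢ v → u <[ τ ] v ⊎ v <[ τ ] u
    ordered u≢v = <-total u≢v (ordering-complete bfs _) (ordering-complete bfs _)

    later-~ : ∀ {u v} → u <[ τ ] v → P v → v ~ u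
    later-~ {u} {v} u<v (w , v<w , w~v) = decidable-stable (v ~? u) λ v≁u →
      avoids (w , v , u , u<v , v<w , w~v , v≁u)

    -- Of two members, the later one has a later neighbour and is therefore adjacent to the earlier
    -- one.
    clique : IsClique G (_∈ˢ subset P?)
    clique u∈ v∈ u≢v with ordered u≢v
    ... | inj₁ u<v = ~-sym (later-~ u<v (∈-subset⁻ P? v∈))
    ... | inj₂ v<u = later-~ v<u (∈-subset⁻ P? u∈)

    -- The earlier end of any edge satisfies `P`.
    independent : IsIndependent G (λ v → ¬ P v)
    independent u∉P v∉P u~v with ordered (~-distinct u~v)
    ... | inj₁ u<v = u∉P (_ , u<v , ~-sym u~v)
    ... | inj₂ v<u = v∉P (_ , v<u , u~v)

  -- Stars.

  avoids⇒star : ∀ {τ} → IsMaxBFSOrdering G τ → ¬ HasLaterEdge τ → IsStar G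
  avoids⇒star {[]} bfs _ =
    avoids⇒split bfs (λ { (_ , _ , _ , () , _) }) ,
    λ {u} → contradiction (ordering-complete bfs u) λ ()
  avoids⇒star {s ∷ σ} bfs avoids =
    avoids⇒split bfs (λ { (a , b , c , c<b , b<a , a~b , _) → avoids (a , b , c , c<b , b<a , a~b) }) ,
    λ u>1 v>1 → trans (centre u>1) (sym (centre v>1))
    where
    ∈-tail : ∀ {v} → v ≢ s → v ∈ σ
    ∈-tail {v} v≢s with ordering-complete bfs v
    ... | here v≡s  = contradiction v≡s v≢s
    ... | there v∈σ = v∈σ

    -- An edge missing `s` lies within `σ` and completes the pattern with `s` as `c`.
    edge-∋s : ∀ {u v} → u ≢ s → u ~ v → v ≡ s
    edge-∋s {u} {v} u≢s u~v = decidable-stable (v ≟ s) λ v≢s →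
      helper v≢s (<-total (~-distinct u~v) (∈-tail u≢s) (∈-tail v≢s))
      where
      helper : v ≢ s → u <[ σ ] v ⊎ v <[ σ ] u → ⊥
      helper v≢s (inj₁ u<v) =
        avoids (v , u , s , refl ∷ from∈ (∈-tail u≢s) , s ∷ʳ u<v , ~-sym u~v)
      helper v≢s (inj₂ v<u) =
        avoids (u , v , s , refl ∷ from∈ (∈-tail v≢s) , s ∷ʳ v<u , u~v)

    centre : ∀ {u} → degree u > 1 → u ≡ s
    centre {u} u>1 = decidable-stable (u ≟ s) λ u≢s → <⇒≱ u>1
      (unique-length-≤ {ys = [ s ]} (neighbours-unique u)
        (λ w∈ → here (edge-∋s u≢s (∈-neighbours⁻ w∈))))

  module _ (star : IsStar G) where

    private
      S = proj₁ (proj₁ star)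
      open SplitPartition (_∈ˢ? S) (proj₁ (proj₂ (proj₁ star))) (proj₂ (proj₂ (proj₁ star)))
        using (outside-neighbour)

      clique : IsClique G (_∈ˢ S)
      clique = proj₁ (proj₂ (proj₁ star))

    -- Vertices other than `s` have degree at most 1, so the edge `u v` is disjoint from an edge
    -- `s w`. Each edge has an end in `S`; these two ends are adjacent, which gives the one on `u v`
    -- a second neighbour.
    star-edge-∋maximum : ∀ {s u v} → (∀ w → degree w ≤ degree s) → u ~ v → u ≢ s → v ≢ s → ⊥
    star-edge-∋maximum {s} {u} {v} max u~v u≢s v≢s = meet (clique-end u~v) (clique-end s~w)
      where
      clique-end : ∀ {x y} → x ~ y → x ∈ˢ S ⊎ y ∈ˢ S
      clique-end {x} x~y with x ∈ˢ? S
      ... | yes x∈S = inj₁ x∈S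
      ... | no  x∉S = inj₂ (outside-neighbour x∉S x~y)

      degree≤1 : ∀ {x} → x ≢ s → degree x ≤ 1
      degree≤1 {x} x≢s with degree x ≤? 1
      ... | yes x≤1 = x≤1
      -- By maximality `s` would also have degree above 1, and a star has at most one such vertex.
      ... | no  x≰1 = contradiction (proj₂ star x>1 (<-≤-trans x>1 (max x))) x≢s
        where x>1 = ≰⇒> x≰1

      only : ∀ {x y z} → x ≢ s → x ~ y → x ~ z → y ≡ z
      only {y = y} {z} x≢s x~y x~z = decidable-stable (y ≟ z) λ y≢z →
        <⇒≱ (length≤degree ((y≢z ∷ []) ∷ [] ∷ []) (x~y ∷ x~z ∷ [])) (degree≤1 x≢s)

      s-neighbour : ∃ (s ~_)
      s-neighbour = neighbour s (≤-trans (length≤degree ([] ∷ []) (u~v ∷ [])) (max u))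

      w = proj₁ s-neighbour
      s~w = proj₂ s-neighbour

      disjoint : ∀ {x y} → x ≢ s → y ≢ s → x ~ y → x ≢ w
      disjoint x≢s y≢s x~y refl = y≢s (only x≢s x~y (~-sym s~w))

      join : ∀ {x y} → x ≢ s → y ≢ s → x ~ y → x ∈ˢ S → s ∈ˢ S ⊎ w ∈ˢ S → ⊥
      join x≢s y≢s x~y x∈S (inj₁ s∈S) =
        y≢s (only x≢s x~y (clique x∈S s∈S x≢s))
      join x≢s y≢s x~y x∈S (inj₂ w∈S) =
        disjoint y≢s x≢s (~-sym x~y)
          (only x≢s x~y (clique x∈S w∈S (disjoint x≢s y≢s x~y)))

      meet : u ∈ˢ S ⊎ v ∈ˢ S → s ∈ˢ S ⊎ w ∈ˢ S → ⊥
      meet (inj₁ u∈S) = join u≢s v≢s u~v u∈S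
      meet (inj₂ v∈S) = join v≢s u≢s (~-sym u~v) v∈S

  star⇒avoids : ∀ {τ} → IsMaxBFSOrdering G τ → IsStar G → ¬ HasLaterEdge τ
  star⇒avoids {[]} _ _ (_ , _ , _ , () , _)
  star⇒avoids {s ∷ σ} bfs star (a , b , c , c<b , b<a , a~b) =
    star-edge-∋maximum star (head-maximum bfs) a~b (≢s a∈σ) (≢s b∈σ)
    where
    ≢s : ∀ {v} → v ∈ σ → v ≢ s
    ≢s v∈σ refl = Unique[x∷xs]⇒x∉xs (ordering-unique bfs) v∈σ

    -- Both `b` and `a` have a predecessor in `τ`, so neither is `s`.
    second∈tail : ∀ {x y} → x <[ s ∷ σ ] y → y ∈ σ
    second∈tail (refl ∷ y∈) = to∈ y∈
    second∈tail (_ ∷ʳ x<y)  = <⇒∈ʳ x<y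

    a∈σ = second∈tail b<a
    b∈σ = second∈tail c<b

-- Transfer to the reversed ordering.

proposition2 : ∀ {n : ℕ} (G : Graph n) (τ : List (Fin n)) → IsMaxBFSOrdering G τ →
    let open Graph G
        τᵈ = reverse τ
    in ((¬ (∃[ a ] ∃[ b ] ∃[ c ] (a <[ τᵈ ] b × b <[ τᵈ ] c × a ~ b))) ⇔ IsStar G)
     × ((¬ (∃[ a ] ∃[ b ] ∃[ c ] (a <[ τᵈ ] b × b <[ τᵈ ] c × a ~ b × ¬ b ~ c))) ⇔ IsSplit G)
proposition2 G τ bfs =
  mk⇔
    (λ avoids → avoids⇒star G bfs λ { (a , b , c , c<b , b<a , a~b) →
      avoids (a , b , c , <-reverse⁺ b<a , <-reverse⁺ c<b , a~b) })
    (λ { star (a , b , c , a<b , b<c , a~b) → star⇒avoids G bfs star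
      (a , b , c , <-reverse⁻ b<c , <-reverse⁻ a<b , a~b) }) ,
  mk⇔
    (λ avoids → avoids⇒split G bfs λ { (a , b , c , c<b , b<a , a~b , b≁c) →
      avoids (a , b , c , <-reverse⁺ b<a , <-reverse⁺ c<b , a~b , b≁c) })
    (λ { split (a , b , c , a<b , b<c , a~b , b≁c) → split⇒avoids G bfs split
      (a , b , c , <-reverse⁻ b<c , <-reverse⁻ a<b , a~b , b≁c) })
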